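{- Let $\vec\sigma=\langle\bar\sigma^\alpha : 1<\alpha<\omega_1\rangle$ be any sequence such that each $\bar\sigma^\alpha=\langle\sigma^\alpha_n : n\in\omega\rangle$ is a sequence of ordinals in $\alpha\setminus 1=\{\xi : 1\le\xi<\alpha\}$ which has supremum $\alpha$ if $\alpha$ is a limit ordinal, and is the constant sequence with value $\alpha-1$ if $\alpha$ is a successor. Then for all ordinals $1\le\alpha<\beta<\omega_1$, $\mathfrak a^{\vec\sigma}_\beta\le\mathfrak a^{\vec\sigma}_\alpha$.
   Context: Work in ZFC. Given $\vec\sigma$ as in the claim, define sets $T^{\vec\sigma}_\alpha$ of finite sequences of natural numbers by recursion on $1\le\alpha<\omega_1$: $T^{\vec\sigma}_1={}^1\omega$ (the sequences of length $1$), and $T^{\vec\sigma}_\alpha=\{\langle n\rangle^\frown t : n\in\omega,\ t\in T^{\vec\sigma}_{\sigma^\alpha_n}\}$ for $\alpha>1$. Let $\mathrm{Fin}^{\vec\sigma,\alpha}$ be the ideal on $T^{\vec\sigma}_\alpha$ defined by recursion as follows: $\mathrm{Fin}^{\vec\sigma,1}$ is the ideal of finite subsets of $T^{\vec\sigma}_1$; for $\alpha>1$ and $X\subseteq T^{\vec\sigma}_\alpha$, $$X\in\mathrm{Fin}^{\vec\sigma,\alpha}\iff\{n\in\omega : \{t : \langle n\rangle^\frown t\in X\}\notin\mathrm{Fin}^{\vec\sigma,\sigma^\alpha_n}\}\text{ is finite}.$$ Let $\mathcal I$ be an ideal on a countable set $S$. An $\mathcal I$-almost disjoint family is a set $\mathcal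 A\subseteq\mathcal P(S)\setminus\mathcal I$ such that $A\cap B\in\mathcal I$ for all distinct $A,B\in\mathcal A$. An $\mathcal I$-mad family is an $\mathcal I$-almost disjoint family that is maximal under inclusion among such families. $\mathfrak a_{\mathcal I}$ is the least cardinality of an infinite $\mathcal I$-mad family, and $\mathfrak a^{\vec\sigma}_\alpha=\mathfrak a_{\mathcal I}$ for $\mathcal I=\mathrm{Fin}^{\vec\sigma,\alpha}$. -}

module Defs where

open import Level using (Level; 0ℓ; _⊔_) renaming (suc to lsuc)
open import Data.Nat.Base using (ℕ)
open import Data.List.Base using (List; _∷_; length)
open import Data.List.Relation.Unary.Enumerates.Setoid using (IsEnumeration)
open import Data.Product.Base using (Σ; ∃; ∃₂; _×_; _,_; proj₁)
open import Data.Sum.Base using (_⊎_)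
open import Function.Bundles using (Bijection; Injection)
open import Induction.WellFounded using (Acc; acc; WellFounded)
open import Relation.Binary.Bundles using (Setoid)
import Relation.Binary.Construct.On as On
open import Relation.Binary.PropositionalEquality using (_≡_; setoid)
open import Relation.Nullary.Negation using (¬_)
open import Relation.Unary using (Pred; _∈_; _∉_; _⊆_; _∩_; _≐_)
open import Relation.Unary.Relation.Binary.Equality using (≐-setoid)

------------------------------------------------------------------------
-- Countable ordinals

-- `lsub f` is the least ordinal strictly above every `f n`, i.e. the
-- von Neumann ordinal whose elements are the ordinals ≤ some `f n`.
-- Every nonzero α < ω₁ is `lsub` of an enumeration of its elements, so,
-- classically, these trees modulo _≈_ are exactly the ordinals below ω₁.
data Ord : Set where
  zero : Ord
  lsub : (ℕ → Ord) → Ord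

infix 4 _≤_ _<_ _≈_

mutual
  data _≤_ : Ord → Ord → Set where
    zero≤ : ∀ {β} → zero ≤ β
    lsub≤ : ∀ {f β} → (∀ n → f n < β) → lsub f ≤ β

  data _<_ : Ord → Ord → Set where
    <lsub : ∀ {α g} (m : ℕ) → α ≤ g m → α < lsub g

_≈_ : Ord → Ord → Set
α ≈ β = α ≤ β × β ≤ α

suc : Ord → Ord
suc α = lsub (λ _ → α)

one : Ord
one = suc zero

IsLimit : Ord → Set
IsLimit α = zero < α × (∀ γ → ¬ (α ≈ suc γ))

IsSupremum : (ℕ → Ord) → Ord → Set
IsSupremum f α = (∀ n → f n ≤ α) × (∀ γ → (∀ n → f n ≤ γ) → α ≤ γ)

mutual
  ≤-trans : ∀ {α β γ} → α ≤ β → β ≤ γ → α ≤ γ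
  ≤-trans zero≤     q = zero≤
  ≤-trans (lsub≤ h) q = lsub≤ (λ n → <-≤-trans (h n) q)

  <-≤-trans : ∀ {α β γ} → α < β → β ≤ γ → α < γ
  <-≤-trans (<lsub m p) (lsub≤ h) = ≤-<-trans p (h m)

  ≤-<-trans : ∀ {α β γ} → α ≤ β → β < γ → α < γ
  ≤-<-trans p (<lsub m q) = <lsub m (≤-trans p q)

<-wellFounded : WellFounded _<_
<-wellFounded zero     = acc λ ()
<-wellFounded (lsub f) = acc λ { (<lsub m p) → below p (<-wellFounded (f m)) }
  where
  below : ∀ {α β} → α ≤ β → Acc _<_ β → Acc _<_ α
  below p (acc rs) = acc λ q → rs (<-≤-trans q p)

------------------------------------------------------------------------
-- The sequences σ⃗

-- `σ` is total for convenience; its values at α ≤ 1 are unconstrained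
-- and are never used.
record OrdinalSequences : Set where
  field
    σ           : Ord → ℕ → Ord
    σ-cong      : ∀ {α β} → one < α → α ≈ β → ∀ n → σ α n ≈ σ β n
    σ-positive  : ∀ {α} → one < α → ∀ n → one ≤ σ α n
    σ-below     : ∀ {α} → one < α → ∀ n → σ α n < α
    σ-limit     : ∀ {α} → one < α → IsLimit α → IsSupremum (σ α) α
    σ-successor : ∀ {α γ} → one < α → α ≈ suc γ → ∀ n → σ α n ≈ γ

------------------------------------------------------------------------
-- Cardinality of subsets of a setoid; cardinals are setoids up to
-- bijection

private
  variable
    a ℓ p : Level

subsetoid : (S : Setoid a ℓ) → Pred (Setoid.Carrier S) p → Setoid (a ⊔ p) ℓ
subsetoid S P = On.setoid {B = Σ (Setoid.Carrier S) P} S proj₁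

Finite : Setoid a ℓ → Set (a ⊔ ℓ)
Finite S = ∃ (IsEnumeration S)

FiniteSubset : {A : Set a} → Pred A p → Set (a ⊔ p)
FiniteSubset {A = A} P = Finite (subsetoid (setoid A) P)

------------------------------------------------------------------------
-- The sets T and the ideals Fin

section : ℕ → Pred (List ℕ) 0ℓ → Pred (List ℕ) 0ℓ
section n X t = (n ∷ t) ∈ X

module _ (σ⃗ : OrdinalSequences) where
  open OrdinalSequences σ⃗

  T-rec : ∀ α → Acc _<_ α → Pred (List ℕ) 0ℓ
  T-rec α (acc rs) s =
      (α ≈ one × length s ≡ 1)
    ⊎ Σ (one < α) λ 1<α → ∃₂ λ n t →
        s ≡ n ∷ t × t ∈ T-rec (σ α n) (rs (σ-below 1<α n))

  T : Ord → Pred (List ℕ) 0ℓ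
  T α = T-rec α (<-wellFounded α)

  -- Exactly one of the two implications is non-vacuous when 1 ≤ α.
  FinIdeal-rec : ∀ α → Acc _<_ α → Pred (Pred (List ℕ) 0ℓ) 0ℓ
  FinIdeal-rec α (acc rs) X =
      (α ≈ one → FiniteSubset X)
    × ((1<α : one < α) → FiniteSubset λ n →
        section n X ∉ FinIdeal-rec (σ α n) (rs (σ-below 1<α n)))

  FinIdeal : Ord → Pred (Pred (List ℕ) 0ℓ) 0ℓ
  FinIdeal α X = X ⊆ T α × X ∈ FinIdeal-rec α (<-wellFounded α)

------------------------------------------------------------------------
-- Almost disjoint families modulo an ideal I on a set S of elements of A

Family : Set → Set₂
Family A = Pred (Pred A 0ℓ) (lsuc 0ℓ)

-- Subsets are identified up to _≐_, so the cardinality of a family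
-- counts its members modulo _≐_.
members : {A : Set} → Family A → Setoid (lsuc 0ℓ) 0ℓ
members {A} 𝒜 = subsetoid (≐-setoid A 0ℓ) 𝒜

module _ {A : Set} (S : Pred A 0ℓ) (I : Pred (Pred A 0ℓ) 0ℓ) where

  record IsAlmostDisjoint (𝒜 : Family A) : Set₁ where
    field
      extensional    : ∀ {X Y} → X ≐ Y → X ∈ 𝒜 → Y ∈ 𝒜
      subsets        : ∀ {X} → X ∈ 𝒜 → X ⊆ S
      positive       : ∀ {X} → X ∈ 𝒜 → X ∉ I
      almostDisjoint : ∀ {X Y} → X ∈ 𝒜 → Y ∈ 𝒜 → ¬ (X ≐ Y) → (X ∩ Y) ∈ I

  record IsMad (𝒜 : Family A) : Set₂ where
    field
      isAlmostDisjoint : IsAlmostDisjoint 𝒜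
      maximal          : ∀ ℬ → IsAlmostDisjoint ℬ → 𝒜 ⊆ ℬ → ℬ ⊆ 𝒜

  record IsInfiniteMad (𝒜 : Family A) : Set₂ where
    field
      isMad    : IsMad 𝒜
      infinite : ¬ Finite (members 𝒜)

  -- κ is the cardinal 𝔞 of I: the least cardinality of an infinite mad
  -- family.
  record Is𝔞 (κ : Setoid (lsuc 0ℓ) 0ℓ) : Set₂ where
    field
      attained : ∃ λ 𝒜 → IsInfiniteMad 𝒜 × Bijection (members 𝒜) κ
      least    : ∀ 𝒜 → IsInfiniteMad 𝒜 → Injection κ (members 𝒜)

{-# OPTIONS --safe #-}
module Submission where

-- For α ≤ β, T_β is reduced to T_α by recursion.  If 1 < α, choose indices
-- h 0 < h 1 < … with σ^α_m ≤ σ^β_{h m} and pull A ⊆ T_α back to the set of all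
-- ⟨h m⟩⌢t with t in the pullback of the m-th section of A; if α = 1 < β, pull A
-- back to {⟨n⟩⌢t ∈ T_β : ⟨n⟩ ∈ A}.  Pullbacks of a mad family for α form a mad
-- family for β below the pullback of T_α; what is left of T_β is added to one
-- single member, so that the cardinality of the family does not change.

open import Defs
open import Axiom.ExcludedMiddle using (ExcludedMiddle)
open import Data.Empty using (⊥)
open import Data.List.Base using (List; []; _∷_; _++_; map; [_])
open import Data.List.Membership.Propositional using () renaming (_∈_ to _∈ₗ_)
open import Data.List.Membership.Propositional.Properties using (∈-++⁺ˡ; ∈-++⁺ʳ; finite)
open import Data.List.Relation.Unary.Any using (Any; here; there)
import Data.List.Relation.Unary.Any as Any
import Data.List.Relation.Unary.Any.Properties as Any
import Data.Nat.Base as ℕ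
open import Data.Nat.Base using (ℕ)
import Data.Nat.Properties as ℕ
open import Data.Product.Base using (Σ; ∃; _×_; _,_; proj₁; proj₂)
open import Data.Sum.Base using (_⊎_; inj₁; inj₂; [_,_]′)
open import Function.Base using (_∘_; id)
open import Function.Bundles using (Injection; Bijection; mk↣)
import Function.Construct.Composition as Compose
open import Induction.WellFounded using (Acc; acc)
open import Level using (0ℓ; lift; lower) renaming (suc to lsuc)
open import Relation.Binary.Bundles using (Setoid)
open import Relation.Binary.Definitions using (tri<; tri≈; tri>)
open import Relation.Binary.PropositionalEquality using (_≡_; refl; sym; trans; cong; subst)
open import Relation.Nullary.Decidable using (yes; no; map′; decidable-stable)
open import Relation.Nullary.Negation using (¬_; contradiction)
open import Relation.Unary using (Pred; _∈_; _∉_; _⊆_; _∩_; _∪_; _≐_)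
open import Relation.Unary.Properties using (≐-refl; ≐-sym; ≐-trans)

-- Finite sets

module FiniteSets (em : ExcludedMiddle 0ℓ) {A : Set} where

  -- An enumeration of `P` lists elements together with proofs, so the entries of `xs` that satisfy
  -- `P` are selected by excluded middle. Equality in the subsetoid ignores the proofs, so it does
  -- not matter which proof is selected.
  finite-cover : {P : Pred A 0ℓ} (xs : List A) → (∀ {x} → P x → x ∈ₗ xs) → FiniteSubset P
  finite-cover {P} xs covers = collect xs , λ (x , p) → ∈-collect p (covers p)
    where
    collect : List A → List (Σ A P)
    collect []       = []
    collect (x ∷ xs) with em {P x}
    ... | yes p = (x , p) ∷ collect xs
    ... | no  _ = collect xs

    ∈-collect : ∀ {x xs} → P x → x ∈ₗ xs → Any (λ y → x ≡ proj₁ y) (collect xs)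
    ∈-collect {x} {y ∷ _} p i with em {P y} | i
    ... | yes _ | here x≡y = here x≡y
    ... | yes _ | there j  = there (∈-collect p j)
    ... | no ¬p | here refl = contradiction p ¬p
    ... | no _  | there j  = ∈-collect p j

  elements : {P : Pred A 0ℓ} → FiniteSubset P → List A
  elements (xs , _) = map proj₁ xs

  ∈-elements : {P : Pred A 0ℓ} (F : FiniteSubset P) → ∀ {x} → P x → x ∈ₗ elements F
  ∈-elements (xs , enum) p = Any.map⁺ (enum (_ , p))

  finite-∪ : {P Q : Pred A 0ℓ} → FiniteSubset P → FiniteSubset Q → FiniteSubset (P ∪ Q)
  finite-∪ F G = finite-cover (elements F ++ elements G)
    [ ∈-++⁺ˡ ∘ ∈-elements F , ∈-++⁺ʳ (elements F) ∘ ∈-elements G ]′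

  finite-⊆ : {P Q : Pred A 0ℓ} → P ⊆ Q → FiniteSubset Q → FiniteSubset P
  finite-⊆ P⊆Q F = finite-cover (elements F) (∈-elements F ∘ P⊆Q)

  finite-image : {B : Set} {P : Pred B 0ℓ} {Q : Pred A 0ℓ} (f : B → A) →
    (∀ {y} → Q y → ∃ λ x → P x × y ≡ f x) → FiniteSubset P → FiniteSubset Q
  finite-image f onto (xs , enum) = finite-cover (map (f ∘ proj₁) xs) λ q →
    let (x , p , y≡fx) = onto q
    in Any.map⁺ (Any.map (λ x≡ → trans y≡fx (cong f x≡)) (enum (x , p)))

ℕ-infinite : {P : Pred ℕ 0ℓ} → (∀ n → P n) → ¬ FiniteSubset P
ℕ-infinite all (xs , enum) =
  finite (mk↣ id) (map proj₁ xs) λ n → Any.map⁺ (enum (n , all n))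

-- Countable ordinals

≤-refl : ∀ {α} → α ≤ α
≤-refl {zero}   = zero≤
≤-refl {lsub f} = lsub≤ λ n → <lsub n ≤-refl

<⇒≤ : ∀ {α β} → α < β → α ≤ β
<⇒≤ {zero}   _                   = zero≤
<⇒≤ {lsub f} (<lsub m (lsub≤ h)) = lsub≤ λ n → <lsub m (<⇒≤ (h n))

<-irrefl : ∀ {α} → ¬ α < α
<-irrefl {α} = go (<-wellFounded α)
  where
  go : ∀ {α} → Acc _<_ α → ¬ α < α
  go (acc rs) α<α = go (rs α<α) α<α

<suc⇒≤ : ∀ {α β} → α < suc β → α ≤ β
<suc⇒≤ (<lsub _ p) = p

one≤⇒zero< : ∀ {α} → one ≤ α → zero < α
one≤⇒zero< (lsub≤ h) = h 0

module ClassicalOrdinals (em : ExcludedMiddle 0ℓ) where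

  -- If no `f n` is at or above `β`, each of them is strictly below `β` by the recursive call, which
  -- exchanges the arguments and replaces `lsub f` by its subtree `f n`.
  ≤⊎> : ∀ α β → α ≤ β ⊎ β < α
  ≤⊎> zero     β = inj₁ zero≤
  ≤⊎> (lsub f) β with em {∃ λ n → β ≤ f n}
  ... | yes (n , p) = inj₂ (<lsub n p)
  ... | no  ¬p      = inj₁ (lsub≤ λ n → [ (λ p → contradiction (n , p) ¬p) , id ]′ (≤⊎> β (f n)))

  ≈one⊎one< : ∀ {α} → one ≤ α → α ≈ one ⊎ one < α
  ≈one⊎one< {α} 1≤α with ≤⊎> α one
  ... | inj₁ α≤1 = inj₁ (α≤1 , 1≤α)
  ... | inj₂ 1<α = inj₂ 1<α

  -- The witness is the maximum of `ξ` and the first `N` values of `f`; a maximum of finitely many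
  -- ordinals is one of them and so stays below `β`.
  bounded-below : ∀ {β ξ} (f : ℕ → Ord) → ξ < β → (∀ n → f n < β) →
    ∀ N → ∃ λ γ → γ < β × ξ ≤ γ × (∀ {n} → n ℕ.< N → f n ≤ γ)
  bounded-below f ξ<β f<β ℕ.zero    = _ , ξ<β , ≤-refl , λ ()
  bounded-below f ξ<β f<β (ℕ.suc N) with bounded-below f ξ<β f<β N
  ... | γ , γ<β , ξ≤γ , below with ≤⊎> (f N) γ
  ...   | inj₁ fN≤γ = γ , γ<β , ξ≤γ , λ n<1+N →
          [ below , (λ { refl → fN≤γ }) ]′ (ℕ.m≤n⇒m<n∨m≡n (ℕ.s≤s⁻¹ n<1+N))
  ...   | inj₂ γ<fN = f N , f<β N , ≤-trans ξ≤γ (<⇒≤ γ<fN) , λ n<1+N →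
          [ (λ n<N → ≤-trans (below n<N) (<⇒≤ γ<fN)) , (λ { refl → ≤-refl }) ]′
            (ℕ.m≤n⇒m<n∨m≡n (ℕ.s≤s⁻¹ n<1+N))

-- Reductions between ideals and mad families

-- By definition `FinIdeal σ⃗ α` is `fin α ∣ T σ⃗ α`. Splitting off the inclusion lets the arguments
-- about smallness run without carrying it along.
_∣_ : {A : Set} → Pred (Pred A 0ℓ) 0ℓ → Pred A 0ℓ → Pred (Pred A 0ℓ) 0ℓ
(I ∣ S) X = X ⊆ S × X ∈ I

-- Almost disjointness is carried over by `pull-∩` and `pull-∈`, positivity by `pull-∈⁻¹`, and
-- maximality by `shadow`.
record Reduction {A B : Set} (S : Pred A 0ℓ) (I : Pred (Pred A 0ℓ) 0ℓ)
                 (S′ : Pred B 0ℓ) (J : Pred (Pred B 0ℓ) 0ℓ) : Set₁ where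
  field
    pull      : Pred A 0ℓ → Pred B 0ℓ
    pull-⊆    : ∀ {X Y} → X ⊆ Y → pull X ⊆ pull Y
    pull-∩    : ∀ {X Y} → pull X ∩ pull Y ⊆ pull (X ∩ Y)
    pull-S    : pull S ⊆ S′
    pull-∈    : ∀ {X} → X ∈ I → pull X ∈ J
    pull-∈⁻¹  : ∀ {X} → X ⊆ S → pull X ∈ J → X ∈ I
    -- In the contrapositive: every J-positive X below the pullback of S has an
    -- I-positive shadow Y such that a set meeting Y positively has a pullback
    -- meeting X positively.
    shadow    : ∀ {X} → X ⊆ pull S → ∃ λ Y → Y ⊆ S × (Y ∈ I → X ∈ J) ×
                  (∀ A → (pull A ∩ X) ∈ J → (A ∩ Y) ∈ I)

module TransferMad (em : ExcludedMiddle (lsuc 0ℓ)) {A B : Set}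
  {S : Pred A 0ℓ} {I : Pred (Pred A 0ℓ) 0ℓ} {S′ : Pred B 0ℓ} {J : Pred (Pred B 0ℓ) 0ℓ}
  (I-⊆ : ∀ {X Y} → X ⊆ Y → Y ∈ I → X ∈ I)
  (J-⊆ : ∀ {X Y} → X ⊆ Y → Y ∈ J → X ∈ J) (J-∪ : ∀ {X Y} → X ∈ J → Y ∈ J → (X ∪ Y) ∈ J)
  (red : Reduction S I S′ J)
  (𝒜 : Family A) (infiniteMad : IsInfiniteMad S (I ∣ S) 𝒜) where

  open Reduction red
  open IsInfiniteMad infiniteMad
  open IsMad isMad
  open IsAlmostDisjoint isAlmostDisjoint

  em₀ : ExcludedMiddle 0ℓ
  em₀ = map′ lower lift em

  -- An empty family would be enumerated by the empty list. The member found here is the one that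
  -- receives `rest`.
  member : ∃ (_∈ 𝒜)
  member with em {∃ (_∈ 𝒜)}
  ... | yes m = m
  ... | no ¬m = contradiction ([] , λ m → contradiction m ¬m) infinite

  A₀ : Pred A 0ℓ
  A₀ = proj₁ member

  rest : Pred B 0ℓ
  rest s = s ∈ S′ × s ∉ pull S

  -- The condition `X ≐ A₀` attaches `rest` to a single member; it is tested up to `≐` because
  -- members are counted up to `≐`.
  lifted : Pred A 0ℓ → Pred B 0ℓ
  lifted X = pull X ∪ (λ s → X ≐ A₀ × s ∈ rest)

  lifted-⊆S′ : ∀ {X} → X ⊆ S → lifted X ⊆ S′
  lifted-⊆S′ X⊆S = [ pull-S ∘ pull-⊆ X⊆S , proj₁ ∘ proj₂ ]′

  lifted-⊆ : ∀ {X Y} → X ≐ Y → lifted X ⊆ lifted Y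
  lifted-⊆ X≐Y (inj₁ s∈)          = inj₁ (pull-⊆ (proj₁ X≐Y) s∈)
  lifted-⊆ X≐Y (inj₂ (X≐A₀ , s∈)) = inj₂ (≐-trans (≐-sym X≐Y) X≐A₀ , s∈)

  lifted-cong : ∀ {X Y} → X ≐ Y → lifted X ≐ lifted Y
  lifted-cong X≐Y = lifted-⊆ X≐Y , lifted-⊆ (≐-sym X≐Y)

  -- At most one of the two lifts contains `rest`, and `rest` is disjoint from every pullback of a
  -- subset of `S`.
  lifted-∩ : ∀ {X Y} → X ⊆ S → Y ⊆ S → ¬ X ≐ Y → lifted X ∩ lifted Y ⊆ pull (X ∩ Y)
  lifted-∩ _ _ _   (inj₁ p , inj₁ q)                 = pull-∩ (p , q)
  lifted-∩ X _ _   (inj₁ p , inj₂ (_ , _ , s∉))      = contradiction (pull-⊆ X p) s∉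
  lifted-∩ _ Y _   (inj₂ (_ , _ , s∉) , inj₁ q)      = contradiction (pull-⊆ Y q) s∉
  lifted-∩ _ _ X≢Y (inj₂ (X≐A₀ , _) , inj₂ (Y≐A₀ , _)) =
    contradiction (≐-trans X≐A₀ (≐-sym Y≐A₀)) X≢Y

  lifted-positive : ∀ {X} → X ∈ 𝒜 → lifted X ∉ J
  lifted-positive X∈𝒜 L∈J =
    positive X∈𝒜 (subsets X∈𝒜 , pull-∈⁻¹ (subsets X∈𝒜) (J-⊆ inj₁ L∈J))

  lifted-disjoint : ∀ {X Y} → X ∈ 𝒜 → Y ∈ 𝒜 → ¬ X ≐ Y → (lifted X ∩ lifted Y) ∈ J
  lifted-disjoint X∈𝒜 Y∈𝒜 X≢Y = J-⊆ (lifted-∩ (subsets X∈𝒜) (subsets Y∈𝒜) X≢Y)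
    (pull-∈ (proj₂ (almostDisjoint X∈𝒜 Y∈𝒜 X≢Y)))

  -- Distinct members have lifts with intersection in `J`; if the lifts coincided, this intersection
  -- would be the positive set `lifted X`.
  lifted-injective : ∀ {X Y} → X ∈ 𝒜 → Y ∈ 𝒜 → lifted X ≐ lifted Y → X ≐ Y
  lifted-injective X∈𝒜 Y∈𝒜 (⊆ , _) = decidable-stable em₀ λ X≢Y →
    lifted-positive X∈𝒜 (J-⊆ (λ s∈ → s∈ , ⊆ s∈) (lifted-disjoint X∈𝒜 Y∈𝒜 X≢Y))

  ℬ : Family B
  ℬ Z = ∃ λ X → X ∈ 𝒜 × Z ≐ lifted X

  ℬ-almostDisjoint : IsAlmostDisjoint S′ (J ∣ S′) ℬ
  ℬ-almostDisjoint = record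
    { extensional    = λ { Z≐W (X , X∈𝒜 , Z≐) → X , X∈𝒜 , ≐-trans (≐-sym Z≐W) Z≐ }
    ; subsets        = ℬ-subsets
    ; positive       = λ { (X , X∈𝒜 , Z≐) (_ , Z∈J) → lifted-positive X∈𝒜 (J-⊆ (proj₂ Z≐) Z∈J) }
    ; almostDisjoint = λ { Z∈ℬ@(X , X∈𝒜 , Z≐) (Y , Y∈𝒜 , W≐) Z≢W →
        ℬ-subsets Z∈ℬ ∘ proj₁ ,
        J-⊆ (λ (z , w) → proj₁ Z≐ z , proj₁ W≐ w) (lifted-disjoint X∈𝒜 Y∈𝒜 λ X≐Y →
          Z≢W (≐-trans Z≐ (≐-trans (lifted-cong X≐Y) (≐-sym W≐)))) }
    }
    where
    ℬ-subsets : ∀ {Z} → Z ∈ ℬ → Z ⊆ S′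
    ℬ-subsets (X , X∈𝒜 , Z≐) = lifted-⊆S′ (subsets X∈𝒜) ∘ proj₁ Z≐

  meets-positively : ∀ {Y} → Y ⊆ S → Y ∉ I → ∃ λ X → X ∈ 𝒜 × (X ∩ Y) ∉ I
  meets-positively {Y} Y⊆S Y∉I with em {∃ λ X → X ∈ 𝒜 × (X ∩ Y) ∉ I}
  ... | yes X = X
  -- In this case `Y` could be added to `𝒜`, so by maximality it already belongs to `𝒜`, and it
  -- meets itself positively.
  ... | no ¬X = Y , maximal 𝒜+Y 𝒜+Y-almostDisjoint inj₁ (inj₂ ≐-refl) , Y∉I ∘ I-⊆ λ s∈ → s∈ , s∈
    where
    𝒜+Y : Family A
    𝒜+Y Z = Z ∈ 𝒜 ⊎ Z ≐ Y

    disjoint-Y : ∀ {X} → X ∈ 𝒜 → (X ∩ Y) ∈ I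
    disjoint-Y X∈𝒜 = decidable-stable em₀ λ XY∉I → ¬X (_ , X∈𝒜 , XY∉I)

    𝒜+Y-almostDisjoint : IsAlmostDisjoint S (I ∣ S) 𝒜+Y
    𝒜+Y-almostDisjoint = record
      { extensional    = λ Z≐W → [ inj₁ ∘ extensional Z≐W , inj₂ ∘ ≐-trans (≐-sym Z≐W) ]′
      ; subsets        = λ
          { (inj₁ Z∈𝒜) → subsets Z∈𝒜
          ; (inj₂ Z≐Y) → Y⊆S ∘ proj₁ Z≐Y }
      ; positive       = λ
          { (inj₁ Z∈𝒜)       → positive Z∈𝒜
          ; (inj₂ Z≐Y) (_ , Z∈I) → Y∉I (I-⊆ (proj₂ Z≐Y) Z∈I) }
      ; almostDisjoint = λ
          { (inj₁ Z∈𝒜) (inj₁ W∈𝒜) Z≢W → almostDisjoint Z∈𝒜 W∈𝒜 Z≢W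
          ; (inj₁ Z∈𝒜) (inj₂ W≐Y) _   →
              subsets Z∈𝒜 ∘ proj₁ , I-⊆ (λ (z , w) → z , proj₁ W≐Y w) (disjoint-Y Z∈𝒜)
          ; (inj₂ Z≐Y) (inj₁ W∈𝒜) _   →
              subsets W∈𝒜 ∘ proj₂ , I-⊆ (λ (z , w) → w , proj₁ Z≐Y z) (disjoint-Y W∈𝒜)
          ; (inj₂ Z≐Y) (inj₂ W≐Y) Z≢W → contradiction (≐-trans Z≐Y (≐-sym W≐Y)) Z≢W }
      }

  -- A member `Z` of `𝒞` outside `ℬ` is almost disjoint from every lift. Its part outside `pull S`
  -- lies in `lifted A₀`, hence is small, so `Z ∩ pull S` is positive and has a positive shadow.
  -- Some member of `𝒜` meets the shadow positively, and then its lift meets `Z` positively, a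
  -- contradiction.
  ℬ-maximal : ∀ 𝒞 → IsAlmostDisjoint S′ (J ∣ S′) 𝒞 → ℬ ⊆ 𝒞 → 𝒞 ⊆ ℬ
  ℬ-maximal 𝒞 ad ℬ⊆𝒞 {Z} Z∈𝒞 = decidable-stable em λ Z∉ℬ →
    let
      disjoint : ∀ {X} → X ∈ 𝒜 → (lifted X ∩ Z) ∈ J
      disjoint {X} X∈𝒜 = proj₂ (𝒞.almostDisjoint (ℬ⊆𝒞 (X , X∈𝒜 , ≐-refl)) Z∈𝒞
        λ L≐Z → Z∉ℬ (X , X∈𝒜 , ≐-sym L≐Z))

      (Y , Y⊆S , reflects , shadows) = shadow {X = Z ∩ pull S} proj₂

      Y∉I : Y ∉ I
      Y∉I Y∈I = 𝒞.positive Z∈𝒞 (𝒞.subsets Z∈𝒞 ,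
        J-⊆ split (J-∪ (disjoint (proj₂ member)) (reflects Y∈I)))

      (X , X∈𝒜 , XY∉I) = meets-positively Y⊆S Y∉I
    in XY∉I (shadows X (J-⊆ (λ (p , z , _) → inj₁ p , z) (disjoint X∈𝒜)))
    where
    module 𝒞 = IsAlmostDisjoint ad

    split : Z ⊆ (lifted A₀ ∩ Z) ∪ (Z ∩ pull S)
    split {s} z with em₀ {s ∈ pull S}
    ... | yes s∈ = inj₂ (z , s∈)
    ... | no  s∉ = inj₁ (inj₂ (≐-refl , 𝒞.subsets Z∈𝒞 z , s∉) , z)

  -- Each member of `ℬ` is sent to the set it was lifted from; `lifted-injective` makes this
  -- independent of the representative.
  ℬ↣𝒜 : Injection (members ℬ) (members 𝒜)
  ℬ↣𝒜 = record
    { to        = λ (_ , X , X∈𝒜 , _) → X , X∈𝒜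
    ; cong      = λ { {_ , _ , X∈𝒜 , Z≐} {_ , _ , Y∈𝒜 , W≐} Z≐W →
        lifted-injective X∈𝒜 Y∈𝒜 (≐-trans (≐-sym Z≐) (≐-trans Z≐W W≐)) }
    ; injective = λ { {_ , _ , _ , Z≐} {_ , _ , _ , W≐} X≐Y →
        ≐-trans Z≐ (≐-trans (lifted-cong X≐Y) (≐-sym W≐)) }
    }

  ℬ-infiniteMad : IsInfiniteMad S′ (J ∣ S′) ℬ
  ℬ-infiniteMad = record
    { isMad    = record { isAlmostDisjoint = ℬ-almostDisjoint ; maximal = ℬ-maximal }
    ; infinite = λ (xs , enum) → infinite (map to xs , λ (X , X∈𝒜) →
        Any.map⁺ (Any.map (λ {Z} → Injection.cong ℬ↣𝒜 {lifted X , X , X∈𝒜 , ≐-refl} {Z})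
          (enum (lifted X , X , X∈𝒜 , ≐-refl))))
    }
    where open Injection ℬ↣𝒜 using (to)

-- The ideals Fin

module Ideals (em : ExcludedMiddle 0ℓ) (σ⃗ : OrdinalSequences) where
  open OrdinalSequences σ⃗
  open FiniteSets em
  open ClassicalOrdinals em

  fin : Ord → Pred (Pred (List ℕ) 0ℓ) 0ℓ
  fin α = FinIdeal-rec σ⃗ α (<-wellFounded α)

  -- The recursion descends to accessibility proofs other than those given by `<-wellFounded`.
  -- Independence of the proof is what lets the unfolding rules below speak of `T` and `fin` alone.
  T-irrelevant : ∀ {α} (a b : Acc _<_ α) → T-rec σ⃗ α a ⊆ T-rec σ⃗ α b
  T-irrelevant (acc _) (acc _) (inj₁ base) = inj₁ base
  T-irrelevant (acc r) (acc s) (inj₂ (1<α , n , t , eq , t∈)) =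
    inj₂ (1<α , n , t , eq , T-irrelevant (r _) (s _) t∈)

  fin-irrelevant : ∀ {α} (a b : Acc _<_ α) → FinIdeal-rec σ⃗ α a ⊆ FinIdeal-rec σ⃗ α b
  fin-irrelevant (acc r) (acc s) (base , step) = base , λ 1<α →
    finite-⊆ (λ ∉b ∈a → ∉b (fin-irrelevant (r _) (s _) ∈a)) (step 1<α)

  T-base⁻ : ∀ {α s} → α ≈ one → s ∈ T σ⃗ α → ∃ λ n → s ≡ [ n ]
  T-base⁻ {α} = go (<-wellFounded α)
    where
    go : ∀ {α s} (a : Acc _<_ α) → α ≈ one → s ∈ T-rec σ⃗ α a → ∃ λ n → s ≡ [ n ]
    go {s = n ∷ []} (acc _) _   (inj₁ _)         = n , refl
    go              (acc _) α≈1 (inj₂ (1<α , _)) = contradiction (<-≤-trans 1<α (proj₁ α≈1)) <-irrefl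

  T-base⁺ : ∀ {α n} → α ≈ one → [ n ] ∈ T σ⃗ α
  T-base⁺ {α} = go (<-wellFounded α)
    where
    go : ∀ {α n} (a : Acc _<_ α) → α ≈ one → [ n ] ∈ T-rec σ⃗ α a
    go (acc _) α≈1 = inj₁ (α≈1 , refl)

  T-step⁻ : ∀ {α s} → one < α → s ∈ T σ⃗ α → ∃ λ n → ∃ λ t → s ≡ n ∷ t × t ∈ T σ⃗ (σ α n)
  T-step⁻ {α} = go (<-wellFounded α)
    where
    go : ∀ {α s} (a : Acc _<_ α) → one < α → s ∈ T-rec σ⃗ α a →
         ∃ λ n → ∃ λ t → s ≡ n ∷ t × t ∈ T σ⃗ (σ α n)
    go (acc _) 1<α (inj₁ (α≈1 , _))          = contradiction (<-≤-trans 1<α (proj₁ α≈1)) <-irrefl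
    go (acc _) 1<α (inj₂ (_ , n , t , eq , t∈)) = n , t , eq , T-irrelevant _ _ t∈

  T-section : ∀ {α n} → one < α → section n (T σ⃗ α) ≐ T σ⃗ (σ α n)
  T-section {α} {n} 1<α = (λ s∈ → to (T-step⁻ 1<α s∈)) , from (<-wellFounded α)
    where
    to : ∀ {t} → (∃ λ m → ∃ λ u → n ∷ t ≡ m ∷ u × u ∈ T σ⃗ (σ α m)) → t ∈ T σ⃗ (σ α n)
    to (_ , _ , refl , t∈) = t∈

    from : ∀ {t} (a : Acc _<_ α) → t ∈ T σ⃗ (σ α n) → n ∷ t ∈ T-rec σ⃗ α a
    from (acc _) t∈ = inj₂ (1<α , n , _ , refl , T-irrelevant _ _ t∈)

  fin-base⁻ : ∀ {α X} → α ≈ one → X ∈ fin α → FiniteSubset X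
  fin-base⁻ {α} α≈1 = go (<-wellFounded α)
    where
    go : ∀ {X} (a : Acc _<_ α) → X ∈ FinIdeal-rec σ⃗ α a → FiniteSubset X
    go (acc _) (base , _) = base α≈1

  fin-base⁺ : ∀ {α X} → α ≈ one → FiniteSubset X → X ∈ fin α
  fin-base⁺ {α} α≈1 F = go (<-wellFounded α)
    where
    go : (a : Acc _<_ α) → _ ∈ FinIdeal-rec σ⃗ α a
    go (acc _) = (λ _ → F) , λ 1<α → contradiction (<-≤-trans 1<α (proj₁ α≈1)) <-irrefl

  positiveSections : Ord → Pred (List ℕ) 0ℓ → Pred ℕ 0ℓ
  positiveSections α X n = section n X ∉ fin (σ α n)

  fin-step⁻ : ∀ {α X} → one < α → X ∈ fin α → FiniteSubset (positiveSections α X)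
  fin-step⁻ {α} 1<α = go (<-wellFounded α)
    where
    go : ∀ {X} (a : Acc _<_ α) → X ∈ FinIdeal-rec σ⃗ α a → FiniteSubset (positiveSections α X)
    go (acc _) (_ , step) = finite-⊆ (λ ∉fin → ∉fin ∘ fin-irrelevant _ _) (step 1<α)

  fin-step⁺ : ∀ {α X} → one < α → FiniteSubset (positiveSections α X) → X ∈ fin α
  fin-step⁺ {α} 1<α F = go (<-wellFounded α)
    where
    go : (a : Acc _<_ α) → _ ∈ FinIdeal-rec σ⃗ α a
    go (acc _) = (λ α≈1 → contradiction (<-≤-trans 1<α (proj₁ α≈1)) <-irrefl)
               , λ _ → finite-⊆ (λ ∉rec → ∉rec ∘ fin-irrelevant _ _) F

  -- The tree of recursive calls in the definitions of `T` and `fin`: inductions on `α` along `σ`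
  -- become structural recursions on it.
  data Unfolding (α : Ord) : Set where
    base : α ≈ one → Unfolding α
    step : one < α → (∀ n → Unfolding (σ α n)) → Unfolding α

  unfold : ∀ {α} → one ≤ α → Unfolding α
  unfold {α} = go (<-wellFounded α)
    where
    go : ∀ {α} → Acc _<_ α → one ≤ α → Unfolding α
    go (acc rs) 1≤α with ≈one⊎one< 1≤α
    ... | inj₁ α≈1 = base α≈1
    ... | inj₂ 1<α = step 1<α λ n → go (rs (σ-below 1<α n)) (σ-positive 1<α n)

  fin-⊆ : ∀ {α X Y} → Unfolding α → X ⊆ Y → Y ∈ fin α → X ∈ fin α
  fin-⊆ (base α≈1)    X⊆Y F = fin-base⁺ α≈1 (finite-⊆ X⊆Y (fin-base⁻ α≈1 F))
  fin-⊆ (step 1<α us) X⊆Y F = fin-step⁺ 1<α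
    (finite-⊆ (λ {n} X∉ Y∈ → X∉ (fin-⊆ (us n) X⊆Y Y∈)) (fin-step⁻ 1<α F))

  fin-∪ : ∀ {α X Y} → Unfolding α → X ∈ fin α → Y ∈ fin α → (X ∪ Y) ∈ fin α
  fin-∪ (base α≈1) F G = fin-base⁺ α≈1 (finite-∪ (fin-base⁻ α≈1 F) (fin-base⁻ α≈1 G))
  fin-∪ {α} {X} {Y} (step 1<α us) F G = fin-step⁺ 1<α
    (finite-⊆ split (finite-∪ (fin-step⁻ 1<α F) (fin-step⁻ 1<α G)))
    where
    split : positiveSections α (X ∪ Y) ⊆ positiveSections α X ∪ positiveSections α Y
    split {n} XY∉ with em {section n X ∈ fin (σ α n)}
    ... | yes X∈ = inj₂ λ Y∈ → XY∉ (fin-∪ (us n) X∈ Y∈)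
    ... | no  X∉ = inj₁ X∉

  fin-∅ : ∀ {α X} → Unfolding α → (∀ {s} → s ∉ X) → X ∈ fin α
  fin-∅ (base α≈1)    empty = fin-base⁺ α≈1 ([] , λ (_ , s∈) → contradiction s∈ empty)
  fin-∅ (step 1<α us) empty = fin-step⁺ 1<α ([] , λ (n , X∉) → contradiction (fin-∅ (us n) empty) X∉)

  T-positive : ∀ {α} → Unfolding α → T σ⃗ α ∉ fin α
  T-positive (base α≈1) F = ℕ-infinite {P = λ n → [ n ] ∈ T σ⃗ _} (λ _ → T-base⁺ α≈1)
    (finite-image (λ { [] → 0 ; (n ∷ _) → n }) (λ s∈ → _ , s∈ , refl) (fin-base⁻ α≈1 F))
  T-positive (step 1<α us) F = ℕ-infinite
    (λ n T∈ → T-positive (us n) (fin-⊆ (us n) (proj₂ (T-section 1<α)) T∈)) (fin-step⁻ 1<α F)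

  nonempty-section : ∀ {α X n} → Unfolding (σ α n) → n ∈ positiveSections α X → ∃ λ t → n ∷ t ∈ X
  nonempty-section u X∉ = decidable-stable em λ ¬t → X∉ (fin-∅ u λ t∈ → ¬t (_ , t∈))

  -- Reductions between the ideals Fin

  FinReduction : Ord → Ord → Set₁
  FinReduction α β = Reduction (T σ⃗ α) (fin α) (T σ⃗ β) (fin β)

  reduce-one-one : ∀ {α β} → α ≈ one → β ≈ one → FinReduction α β
  reduce-one-one {α} {β} α≈1 β≈1 = record
    { pull     = id
    ; pull-⊆   = id
    ; pull-∩   = id
    ; pull-S   = T⊆T
    ; pull-∈   = fin-base⁺ β≈1 ∘ fin-base⁻ α≈1
    ; pull-∈⁻¹ = λ _ → β⇒α
    ; shadow   = λ {X} X⊆T → X , X⊆T , fin-base⁺ β≈1 ∘ fin-base⁻ α≈1 , λ _ → β⇒α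
    }
    where
    β⇒α : ∀ {X} → X ∈ fin β → X ∈ fin α
    β⇒α = fin-base⁺ α≈1 ∘ fin-base⁻ β≈1

    T⊆T : T σ⃗ α ⊆ T σ⃗ β
    T⊆T s∈ with T-base⁻ α≈1 s∈
    ... | _ , refl = T-base⁺ β≈1

  module OneToHigher {α β} (α≈1 : α ≈ one) (1<β : one < β) (us : ∀ n → Unfolding (σ β n)) where

    pull : Pred (List ℕ) 0ℓ → Pred (List ℕ) 0ℓ
    pull A []      = ⊥
    pull A (n ∷ t) = [ n ] ∈ A × n ∷ t ∈ T σ⃗ β

    heads-in : Pred ℕ 0ℓ → Pred (List ℕ) 0ℓ
    heads-in N s = ∃ λ n → s ≡ [ n ] × n ∈ N

    fin-heads : ∀ {A N} → (∀ {s} → s ∈ A → ∃ λ n → s ≡ [ n ] × n ∈ N) → FiniteSubset N → A ∈ fin α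
    fin-heads A⊆ F = fin-base⁺ α≈1
      (finite-image [_] (λ s∈ → let (n , eq , n∈) = A⊆ s∈ in n , n∈ , eq) F)

    heads-finite : ∀ {A N} → (∀ {n} → n ∈ N → [ n ] ∈ A) → A ∈ fin α → FiniteSubset N
    heads-finite N⊆ F =
      finite-image (λ { [] → 0 ; (n ∷ _) → n }) (λ n∈ → _ , N⊆ n∈ , refl) (fin-base⁻ α≈1 F)

    reduce : FinReduction α β
    reduce = record
      { pull     = pull
      ; pull-⊆   = λ { X⊆Y {_ ∷ _} (n∈ , s∈) → X⊆Y n∈ , s∈ }
      ; pull-∩   = λ { {x = _ ∷ _} ((n∈X , s∈) , (n∈Y , _)) → (n∈X , n∈Y) , s∈ }
      ; pull-S   = λ { {_ ∷ _} (_ , s∈) → s∈ }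
      ; pull-∈   = λ {X} F → fin-step⁺ 1<β (heads-finite
          (λ {n} n∉ → proj₁ (proj₂ (nonempty-section {X = pull X} (us n) n∉))) F)
      -- For `[ n ]` in `X` the section of `pull X` at `n` is all of `T σ⃗ (σ β n)`, which is
      -- positive; there are only finitely many such `n`.
      ; pull-∈⁻¹ = λ {X} X⊆T F → fin-heads
          (λ s∈ → let (n , eq) = T-base⁻ α≈1 (X⊆T s∈) in
            n , eq , λ n∈fin → T-positive (us n)
              (fin-⊆ (us n) (λ t∈ → subst X eq s∈ , proj₂ (T-section 1<β) t∈) n∈fin))
          (fin-step⁻ 1<β F)
      -- The shadow collects the heads at which `X` has a positive section. If `[ n ]` is in `A`,
      -- then `pull A` contains the whole section of `X` at `n`, so that section of `pull A ∩ X`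
      -- remains positive.
      ; shadow   = λ {X} X⊆ → heads-in (positiveSections β X)
          , (λ { (n , refl , _) → T-base⁺ α≈1 })
          , (λ F → fin-step⁺ 1<β (heads-finite (λ {n} n∈ → n , refl , n∈) F))
          , λ A F → fin-heads
              (λ { (n∈A , n , refl , n∈) → n , refl , λ n∈fin →
                n∈ (fin-⊆ (us n) (λ t∈X → (n∈A , proj₂ (X⊆ t∈X)) , t∈X) n∈fin) })
              (fin-step⁻ 1<β F)
      }

  module StepToStep {α β} (1<α : one < α) (1<β : one < β)
    (us : ∀ m → Unfolding (σ α m)) (vs : ∀ n → Unfolding (σ β n))
    (h : ℕ → ℕ) (h-injective : ∀ {m n} → h m ≡ h n → m ≡ n)
    (red : ∀ m → FinReduction (σ α m) (σ β (h m))) where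

    module Red m = Reduction (red m)

    pull : Pred (List ℕ) 0ℓ → Pred (List ℕ) 0ℓ
    pull A []      = ⊥
    pull A (n ∷ t) = ∃ λ m → n ≡ h m × t ∈ Red.pull m (section m A)

    -- A left inverse of `h`, with default value 0 off its range; total, so that `finite-image` can
    -- carry finite sets of indices back along it.
    h⁻¹ : ℕ → ℕ
    h⁻¹ n with em {∃ λ m → n ≡ h m}
    ... | yes (m , _) = m
    ... | no  _       = 0

    h⁻¹-h : ∀ m → m ≡ h⁻¹ (h m)
    h⁻¹-h m with em {∃ λ m′ → h m ≡ h m′}
    ... | yes (_ , eq) = h-injective eq
    ... | no  ¬m       = contradiction (m , refl) ¬m

    -- Injectivity of `h` enters here: otherwise the section at `h m` could also collect pullbacks
    -- of other sections of `A`.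
    section-pull : ∀ {A m} → section (h m) (pull A) ⊆ Red.pull m (section m A)
    section-pull (_ , eq , t∈) with h-injective eq
    ... | refl = t∈

    -- Sections of `B` off the range of `h` are empty and thus small, so every positive one sits at
    -- some `h m` for which the section of `A` at `m` is positive.
    fin-along-h : ∀ {A B} → (∀ m → section m A ∈ fin (σ α m) → section (h m) B ∈ fin (σ β (h m))) →
      (∀ {n t} → n ∷ t ∈ B → ∃ λ m → n ≡ h m) → A ∈ fin α → B ∈ fin β
    fin-along-h {A} {B} sections heads F = fin-step⁺ 1<β (finite-image h onto (fin-step⁻ 1<α F))
      where
      onto : ∀ {n} → n ∈ positiveSections β B → ∃ λ m → m ∈ positiveSections α A × n ≡ h m
      onto {n} n∉ with heads (proj₂ (nonempty-section {X = B} (vs n) n∉))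
      ... | m , refl = m , n∉ ∘ sections m , refl

    fin-along-h⁻¹ : ∀ {A B} → (∀ m → section (h m) B ∈ fin (σ β (h m)) → section m A ∈ fin (σ α m)) →
      B ∈ fin β → A ∈ fin α
    fin-along-h⁻¹ sections F = fin-step⁺ 1<α
      (finite-image h⁻¹ (λ {m} m∉ → h m , m∉ ∘ sections m , h⁻¹-h m) (fin-step⁻ 1<β F))

    reduce : FinReduction α β
    reduce = record
      { pull     = pull
      ; pull-⊆   = pull-⊆
      ; pull-∩   = λ { {X} {Y} {_ ∷ _} ((m , refl , t∈X) , t∈Y) →
          m , refl , Red.pull-∩ m (t∈X , section-pull {Y} t∈Y) }
      ; pull-S   = λ { {_ ∷ _} (m , refl , t∈) → proj₂ (T-section 1<β)
          (Red.pull-S m (Red.pull-⊆ m (proj₁ (T-section 1<α)) t∈)) }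
      ; pull-∈   = λ {X} → fin-along-h
          (λ m F → fin-⊆ (vs (h m)) (section-pull {X}) (Red.pull-∈ m F))
          (λ (m , eq , _) → m , eq)
      ; pull-∈⁻¹ = λ {X} X⊆T → fin-along-h⁻¹ λ m F → Red.pull-∈⁻¹ m (proj₁ (T-section 1<α) ∘ X⊆T)
          (fin-⊆ (vs (h m)) (λ t∈ → m , refl , t∈) F)
      ; shadow   = shadow
      }
      where
      pull-⊆ : ∀ {X Y} → X ⊆ Y → pull X ⊆ pull Y
      pull-⊆ X⊆Y {_ ∷ _} (m , eq , t∈) = m , eq , Red.pull-⊆ m X⊆Y t∈

      shadow : ∀ {X} → X ⊆ pull (T σ⃗ α) → ∃ λ Y → Y ⊆ T σ⃗ α × (Y ∈ fin α → X ∈ fin β) ×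
                 (∀ A → (pull A ∩ X) ∈ fin β → (A ∩ Y) ∈ fin α)
      shadow {X} X⊆ = Y , Y⊆T
        , fin-along-h (λ m → proj₁ (proj₂ (proj₂ (shadowₘ m))))
            (λ s∈X → let (m , eq , _) = X⊆ s∈X in m , eq)
        , λ A → fin-along-h⁻¹ λ m F → proj₂ (proj₂ (proj₂ (shadowₘ m))) (section m A)
            (fin-⊆ (vs (h m)) (λ (t∈ , t∈X) → (m , refl , t∈) , t∈X) F)
        where
        -- The shadow is assembled sectionwise: the section of `Y` at `m` is the shadow, under
        -- `red m`, of the section of `X` at `h m`.
        shadowₘ : ∀ m → _
        shadowₘ m = Red.shadow m {X = section (h m) X}
          λ t∈ → Red.pull-⊆ m (proj₁ (T-section 1<α)) (section-pull {T σ⃗ α} (X⊆ t∈))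

        Y : Pred (List ℕ) 0ℓ
        Y []      = ⊥
        Y (m ∷ t) = t ∈ proj₁ (shadowₘ m)

        Y⊆T : Y ⊆ T σ⃗ α
        Y⊆T {m ∷ t} t∈ = proj₂ (T-section 1<α) (proj₁ (proj₂ (shadowₘ m)) t∈)

  -- Cofinality of the sequences and choice of the indices

  σ-cofinal : ∀ {β ξ} → one < β → ξ < β → ∀ N → ∃ λ n → N ℕ.≤ n × ξ ≤ σ β n
  σ-cofinal {β} {ξ} 1<β ξ<β N with em {∃ λ γ → β ≈ suc γ}
  ... | yes (_ , β≈sucγ) = N , ℕ.≤-refl ,
    ≤-trans (<suc⇒≤ (<-≤-trans ξ<β (proj₁ β≈sucγ))) (proj₂ (σ-successor 1<β β≈sucγ N))
  -- At a limit, if all values from `N` on were below `ξ`, the maximum `γ` of `ξ` and the first `N`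
  -- values would bound the whole sequence, although `γ` is less than its supremum `β`.
  ... | no ¬successor = decidable-stable em λ ¬n →
    let
      (γ , γ<β , ξ≤γ , below) = bounded-below (σ β) ξ<β (σ-below 1<β) N

      σ≤γ : ∀ n → σ β n ≤ γ
      σ≤γ n = [ (λ N≤n → [ (λ ξ≤σ → contradiction (n , N≤n , ξ≤σ) ¬n)
                         , (λ σ<ξ → ≤-trans (<⇒≤ σ<ξ) ξ≤γ) ]′ (≤⊎> ξ (σ β n)))
              , below ]′ (ℕ.≤-<-connex N n)

      limit : IsLimit β
      limit = one≤⇒zero< (<⇒≤ 1<β) , λ γ β≈sucγ → ¬successor (γ , β≈sucγ)
    in <-irrefl (≤-<-trans (proj₂ (σ-limit 1<β limit) γ σ≤γ) γ<β)

  module Indices {α β} (1<α : one < α) (1<β : one < β) (α≤β : α ≤ β) where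

    pick : ∀ m N → ∃ λ n → N ℕ.≤ n × σ α m ≤ σ β n
    pick m = σ-cofinal 1<β (<-≤-trans (σ-below 1<α m) α≤β)

    -- The lower bound imposed on `h m`: one more than the preceding value, which makes `h` strictly
    -- increasing.
    next : ℕ → ℕ
    h : ℕ → ℕ
    h m = proj₁ (pick m (next m))
    next ℕ.zero    = 0
    next (ℕ.suc m) = ℕ.suc (h m)

    σ≤σh : ∀ m → σ α m ≤ σ β (h m)
    σ≤σh m = proj₂ (proj₂ (pick m (next m)))

    h-increasing : ∀ {m n} → m ℕ.< n → h m ℕ.< h n
    h-increasing {m} {ℕ.suc n} m<1+n = ℕ.≤-trans
      (ℕ.s≤s ([ ℕ.<⇒≤ ∘ h-increasing , (λ { refl → ℕ.≤-refl }) ]′ (ℕ.m≤n⇒m<n∨m≡n (ℕ.s≤s⁻¹ m<1+n))))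
      (proj₁ (proj₂ (pick (ℕ.suc n) (ℕ.suc (h n)))))

    h-injective : ∀ {m n} → h m ≡ h n → m ≡ n
    h-injective {m} {n} eq with ℕ.<-cmp m n
    ... | tri< m<n _ _ = contradiction (h-increasing m<n) (ℕ.<-irrefl eq)
    ... | tri≈ _ m≡n _ = m≡n
    ... | tri> _ _ n<m = contradiction (h-increasing n<m) (ℕ.<-irrefl (sym eq))

  -- The induction is for `≤` rather than `<`, because the choice of indices gives only
  -- `σ α m ≤ σ β (h m)`; hence the case in which both ordinals are `one`.
  reduce : ∀ {α β} → Unfolding α → Unfolding β → α ≤ β → FinReduction α β
  reduce (base α≈1)    (base β≈1)    _   = reduce-one-one α≈1 β≈1
  reduce (base α≈1)    (step 1<β vs) _   = OneToHigher.reduce α≈1 1<β vs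
  reduce (step 1<α us) (base β≈1)    α≤β =
    contradiction (<-≤-trans 1<α (≤-trans α≤β (proj₁ β≈1))) <-irrefl
  reduce (step 1<α us) (step 1<β vs) α≤β =
    StepToStep.reduce 1<α 1<β us vs h h-injective λ m → reduce (us m) (vs (h m)) (σ≤σh m)
    where open Indices 1<α 1<β α≤β

corollary3p8 : ExcludedMiddle (lsuc 0ℓ) →
    (σ⃗ : OrdinalSequences) (α β : Ord) → one ≤ α → α < β →
    (𝔞α 𝔞β : Setoid (lsuc 0ℓ) 0ℓ) →
    Is𝔞 (T σ⃗ α) (FinIdeal σ⃗ α) 𝔞α →
    Is𝔞 (T σ⃗ β) (FinIdeal σ⃗ β) 𝔞β →
    Injection 𝔞β 𝔞α
corollary3p8 em σ⃗ α β 1≤α α<β 𝔞α 𝔞β isα isβ =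
  -- The family to be lifted is one that attains `𝔞α`; minimality of `𝔞β` is then applied to its
  -- lift `ℬ`.
  let (𝒜 , infiniteMad , 𝒜⤖𝔞α) = Is𝔞.attained isα
      open TransferMad em (fin-⊆ u) (fin-⊆ v) (fin-∪ v) (reduce u v (<⇒≤ α<β)) 𝒜 infiniteMad
  in Compose.injection (Is𝔞.least isβ ℬ ℬ-infiniteMad)
       (Compose.injection ℬ↣𝒜 (Bijection.injection 𝒜⤖𝔞α))
  where
  open Ideals (map′ lower lift em) σ⃗
  u : Unfolding α
  u = unfold 1≤α
  v : Unfolding β
  v = unfold (≤-trans 1≤α (<⇒≤ α<β))
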